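{- Let $G=(V,E,w)$ be a finite connected graph with $|V|=n\ge2$ and weights $w:E\to\mathbb{R}_{>0}$. Then $$\operatorname{OPT}_{\mathrm{free}}(G,w)=\min_{T\in\mathcal T_{\mathrm{conn}}^{\mathrm{bin}}(G)}\ \sum_{xy\in E}w_{xy}\operatorname{diam}_{d_G}\bigl(C_T(x,y)\bigr).$$ In particular, the free optimum $\operatorname{OPT}_{\mathrm{free}}(G,w)$ is attained by the diameter labeling $u_T^{\mathrm{diam}}$ of some connected binary hierarchy $T\in\mathcal T_{\mathrm{conn}}^{\mathrm{bin}}(G)$.
   Context: $d_G$ is the shortest-path metric of the support graph $(V,E)$ with every edge of length $1$; the weights are not edge lengths. An ultrametric on $V$ is a metric $u$ on $V$ with $u(x,y)\le\max\{u(x,z),u(z,y)\}$ for all $x,y,z$; it dominates $d_G$ if $u(x,y)\ge d_G(x,y)$ for all $x,y\in V$. $\operatorname{OPT}_{\mathrm{free}}(G,w)$ is the minimum (a priori, infimum) of $\sum_{xy\in E}w_{xy}u(x,y)$ over all ultrametrics $u$ on $V$ dominating $d_G$. A rooted binary hierarchy $T$ on $V$ is a rooted tree whose leaves are the vertices of $V$ and whose internal nodes have exactly two children; each node is identified with the set of leaves below it (a cluster), and $C_T(x,y)$ is the cluster of the lowest common ancestor of $x,y$. $\mathcal T_{\mathrm{conn}}^{\mathrm{bin}}(G)$ is the set of rooted binary hierarchies on $V$ all of whose clusters induce connected subgraphs of $G$. $\operatorname{diam}_{d_G}(S)=\max_{a,b\in S}d_G(a,b)$. The diameter labeling is $u_T^{\mathrm{diam}}(x,x)=0$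 and $u_T^{\mathrm{diam}}(x,y)=\operatorname{diam}_{d_G}(C_T(x,y))$ for $x\neq y$. -}

module Defs where

open import Algebra.Bundles using (CommutativeRing)
import Algebra.Construct.NaturalChoice.Max as NaturalMax
import Algebra.Definitions.RawMonoid as RawMonoidDefs
open import Data.Bool.Base using (if_then_else_; _∧_)
open import Data.Fin.Base using (Fin)
open import Data.Fin.Properties as Fin using (_≟_; any?)
open import Data.Fin.Subset using (Subset; ⁅_⁆; _∪_; _∈_; ⊤)
open import Data.Fin.Subset.Properties using (_∈?_; ∈⊤)
open import Data.List.Base using (List; []; _∷_; _++_; [_]; map; filter; foldr; allFin; cartesianProduct)
open import Data.List.Extrema.Nat using (max; xs≤max)
open import Data.List.Membership.Propositional.Properties using (∈-map⁺; ∈-filter⁺; ∈-cartesianProduct⁺; ∈-allFin)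
open import Data.List.Relation.Binary.Permutation.Propositional using (_↭_)
open import Data.List.Relation.Unary.All as All using (All; []; _∷_)
open import Data.List.Relation.Unary.All.Properties using (all-filter)
open import Data.Nat.Base as ℕ using (ℕ; zero; suc; z≤n; s≤s)
import Data.Nat.Properties as ℕ
open import Data.Product.Base using (Σ; ∃; _×_; _,_; proj₁; proj₂; uncurry)
open import Data.Sum.Base using (inj₁; inj₂)
open import Data.Tree.Binary using (Tree; leaf; node; module Leaves)
open import Data.Unit.Base using () renaming (⊤ to Unit)
open import Function.Metric.Structures using (IsGeneralMetric)
open import Level using (0ℓ)
open import Relation.Binary.Bundles using (TotalOrder)
open import Relation.Binary.Core using (Rel)
open import Relation.Binary.Construct.Closure.ReflexiveTransitive using (Star; ε; _◅_)
open import Relation.Binary.Definitions using (Decidable; Irreflexive; Symmetric)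
open import Relation.Binary.PropositionalEquality as ≡ using (_≡_; refl; cong; cong₂)
open import Relation.Binary.Structures using (IsDecTotalOrder)
open import Relation.Nullary using (¬_; Dec; yes; no; does; contradiction; map′; _×-dec_)
open import Relation.Unary using (Pred)
import Relation.Unary as U

------------------------------------------------------------------------
-- Real numbers

module Bounds {A : Set} (_≤_ : Rel A 0ℓ) where

  LowerBound UpperBound : Pred A 0ℓ → Pred A 0ℓ
  LowerBound P b = ∀ x → P x → b ≤ x
  UpperBound P b = ∀ x → P x → x ≤ b

  IsInfimum IsSupremum : Pred A 0ℓ → Pred A 0ℓ
  IsInfimum  P v = LowerBound P v × (∀ b → LowerBound P b → b ≤ v)
  IsSupremum P v = UpperBound P v × (∀ b → UpperBound P b → v ≤ b)

-- The reals, given by their characterisation as the Dedekind-complete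
-- ordered field.  As in classical mathematics the order is decidable.
record RealNumbers : Set₁ where
  field
    commutativeRing : CommutativeRing 0ℓ 0ℓ

  open CommutativeRing commutativeRing public
    hiding (_≉_) renaming (refl to ≈-refl; sym to ≈-sym; trans to ≈-trans)

  infix 4 _≤_ _<_

  field
    0≉1             : ¬ (0# ≈ 1#)
    inverse         : ∀ x → ¬ (x ≈ 0#) → ∃ λ y → x * y ≈ 1#
    _≤_             : Rel Carrier 0ℓ
    isDecTotalOrder : IsDecTotalOrder _≈_ _≤_
    +-monoʳ-≤       : ∀ x {y z} → y ≤ z → x + y ≤ x + z
    *-nonNegative   : ∀ {x y} → 0# ≤ x → 0# ≤ y → 0# ≤ x * y

  open Bounds _≤_ public

  field
    complete : (P : Pred Carrier 0ℓ) → ∃ P → ∃ (UpperBound P) → ∃ (IsSupremum P)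

  open IsDecTotalOrder isDecTotalOrder public using
    (isTotalOrder; isPartialOrder; total; antisym; ≤-respˡ-≈; ≤-respʳ-≈)
    renaming (refl to ≤-refl; trans to ≤-trans; reflexive to ≤-reflexive)

  _<_ : Rel Carrier 0ℓ
  x < y = x ≤ y × ¬ (x ≈ y)

  totalOrder : TotalOrder 0ℓ 0ℓ 0ℓ
  totalOrder = record { isTotalOrder = isTotalOrder }

  open NaturalMax totalOrder public using (_⊔_)

  fromℕ : ℕ → Carrier
  fromℕ k = RawMonoidDefs._×_ +-rawMonoid k 1#

  ∑ : {A : Set} → List A → (A → Carrier) → Carrier
  ∑ xs f = foldr (λ x s → f x + s) 0# xs

  -- v is the minimum of f over the elements satisfying P.
  IsMinimumOf : {A : Set} → Pred A 0ℓ → (A → Carrier) → Pred Carrier 0ℓ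
  IsMinimumOf P f v = (∃ λ a → P a × f a ≈ v) × (∀ a → P a → v ≤ f a)

  infimum : (P : Pred Carrier 0ℓ) → ∃ P → ∃ (LowerBound P) → ∃ (IsInfimum P)
  infimum P (p , Pp) lower =
    let v , ub , least = complete (LowerBound P) lower (p , λ b lb → lb p Pp)
    in  v , (λ x Px → least x (λ b lb → lb x Px)) , ub

  +-mono-≤ : ∀ {x y z t} → x ≤ y → z ≤ t → x + z ≤ y + t
  +-mono-≤ {x} {y} {z} {t} x≤y z≤t = ≤-trans (+-monoʳ-≤ x z≤t)
    (≤-respˡ-≈ (+-comm t x) (≤-respʳ-≈ (+-comm t y) (+-monoʳ-≤ t x≤y)))

  +-nonNegative : ∀ {x y} → 0# ≤ x → 0# ≤ y → 0# ≤ x + y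
  +-nonNegative 0≤x 0≤y = ≤-respˡ-≈ (+-identityˡ 0#) (+-mono-≤ 0≤x 0≤y)

  0≤1 : 0# ≤ 1#
  0≤1 with total 0# 1#
  ... | inj₁ 0≤1 = 0≤1
  ... | inj₂ 1≤0 = ≤-respʳ-≈ [-1][-1]≈1 (*-nonNegative 0≤-1 0≤-1)
    where
    open import Algebra.Properties.Ring ring using (-1*x≈-x; -‿involutive)
    0≤-1 : 0# ≤ - 1#
    0≤-1 = ≤-respˡ-≈ (-‿inverseˡ 1#) (≤-respʳ-≈ (+-identityʳ (- 1#)) (+-monoʳ-≤ (- 1#) 1≤0))
    [-1][-1]≈1 : - 1# * - 1# ≈ 1#
    [-1][-1]≈1 = ≈-trans (-1*x≈-x (- 1#)) (-‿involutive 1#)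

  fromℕ-nonNegative : ∀ k → 0# ≤ fromℕ k
  fromℕ-nonNegative zero    = ≤-refl
  fromℕ-nonNegative (suc k) = +-nonNegative 0≤1 (fromℕ-nonNegative k)

  fromℕ-mono-≤ : ∀ {j k} → j ℕ.≤ k → fromℕ j ≤ fromℕ k
  fromℕ-mono-≤ {k = k} z≤n = fromℕ-nonNegative k
  fromℕ-mono-≤ (s≤s j≤k)   = +-monoʳ-≤ 1# (fromℕ-mono-≤ j≤k)

  fromℕ-suc≉0 : ∀ k → ¬ (fromℕ (suc k) ≈ 0#)
  fromℕ-suc≉0 k eq = 0≉1 (antisym 0≤1
    (≤-respʳ-≈ eq (≤-respˡ-≈ (+-identityʳ 1#) (+-monoʳ-≤ 1# (fromℕ-nonNegative k)))))

  ∑-nonNegative : {A : Set} {xs : List A} {f : A → Carrier} →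
                  All (λ x → 0# ≤ f x) xs → 0# ≤ ∑ xs f
  ∑-nonNegative []       = ≤-refl
  ∑-nonNegative (p ∷ ps) = +-nonNegative p (∑-nonNegative ps)

------------------------------------------------------------------------
-- Graphs

record Graph (n : ℕ) : Set₁ where
  infix 4 _~_ _~?_
  field
    _~_      : Rel (Fin n) 0ℓ
    _~?_     : Decidable _~_
    ~-sym    : Symmetric _~_
    ~-irrefl : Irreflexive _≡_ _~_

  -- Each edge is listed once, as the pair of its endpoints in increasing order.
  edges : List (Fin n × Fin n)
  edges = filter (λ (x , y) → (x Fin.<? y) ×-dec (x ~? y))
                 (cartesianProduct (allFin n) (allFin n))

  Connected : Set
  Connected = ∀ x y → Star _~_ x y

  InducesConnected : Pred (Subset n) 0ℓ
  InducesConnected S = ∀ x y → x ∈ S → y ∈ S →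
                       Star (λ a b → a ∈ S × b ∈ S × a ~ b) x y

  data Walk : ℕ → Rel (Fin n) 0ℓ where
    []  : ∀ {x} → Walk 0 x x
    _∷_ : ∀ {k x y z} → x ~ y → Walk k y z → Walk (suc k) x z

  walk? : ∀ k → Decidable (Walk k)
  walk? zero    x y = map′ (λ { refl → [] }) (λ { [] → refl }) (x ≟ y)
  walk? (suc k) x z = map′ (λ (_ , e , p) → e ∷ p) (λ { (e ∷ p) → _ , e , p })
                           (any? (λ y → (x ~? y) ×-dec walk? k y z))

  toWalk : ∀ {x y} → Star _~_ x y → ∃ λ k → Walk k x y
  toWalk ε       = 0 , []
  toWalk (e ◅ p) = let k , q = toWalk p in suc k , e ∷ q

leastℕ : {P : Pred ℕ 0ℓ} → U.Decidable P → ∀ m → P m →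
         ∃ λ k → P k × (∀ j → P j → k ℕ.≤ j)
leastℕ P? zero    p = zero , p , λ _ _ → z≤n
leastℕ P? (suc m) p with P? zero
... | yes p₀ = zero , p₀ , λ _ _ → z≤n
... | no ¬p₀ =
  let k , pₖ , least = leastℕ (λ j → P? (suc j)) m p
  in  suc k , pₖ , λ { zero p₀ → contradiction p₀ ¬p₀ ; (suc j) pⱼ → s≤s (least j pⱼ) }

module GraphMetric {n : ℕ} (G : Graph n) (connected : Graph.Connected G) where
  open Graph G

  shortest : ∀ x y → ∃ λ k → Walk k x y × (∀ j → Walk j x y → k ℕ.≤ j)
  shortest x y = let m , p = toWalk (connected x y) in leastℕ (λ k → walk? k x y) m p

  dist : Fin n → Fin n → ℕ
  dist x y = proj₁ (shortest x y)

  pairsIn : Subset n → List (Fin n × Fin n)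
  pairsIn S = filter (λ (a , b) → (a ∈? S) ×-dec (b ∈? S))
                     (cartesianProduct (allFin n) (allFin n))

  -- The base value 0 of max only matters for S empty.
  diam : Subset n → ℕ
  diam S = max 0 (map (uncurry dist) (pairsIn S))

  dist≤diam : ∀ {S a b} → a ∈ S → b ∈ S → dist a b ℕ.≤ diam S
  dist≤diam {S} {a} {b} a∈S b∈S = All.lookup (xs≤max 0 (map (uncurry dist) (pairsIn S)))
    (∈-map⁺ (uncurry dist) (∈-filter⁺ (λ (a , b) → (a ∈? S) ×-dec (b ∈? S))
      (∈-cartesianProduct⁺ (∈-allFin a) (∈-allFin b)) (a∈S , b∈S)))

------------------------------------------------------------------------
-- Hierarchies

-- Children are ordered here; none of the notions below depends on that order.
BinaryTree : ℕ → Set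
BinaryTree n = Tree Unit (Fin n)

module _ {n : ℕ} where

  cluster : BinaryTree n → Subset n
  cluster (leaf x)     = ⁅ x ⁆
  cluster (node l _ r) = cluster l ∪ cluster r

  clusters : BinaryTree n → List (Subset n)
  clusters t@(leaf _)     = [ cluster t ]
  clusters t@(node l _ r) = cluster t ∷ clusters l ++ clusters r

  IsHierarchy : Pred (BinaryTree n) 0ℓ
  IsHierarchy T = Leaves.toList T ↭ allFin n

  -- The subtree rooted at the lowest common ancestor (of two leaves of the tree).
  lca : BinaryTree n → Fin n → Fin n → BinaryTree n
  lca t@(leaf _)     x y = t
  lca t@(node l _ r) x y =
    if does (x ∈? cluster l) ∧ does (y ∈? cluster l) then lca l x y else
    if does (x ∈? cluster r) ∧ does (y ∈? cluster r) then lca r x y else t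

  lcaCluster : BinaryTree n → Fin n → Fin n → Subset n
  lcaCluster T x y = cluster (lca T x y)

  IsConnectedHierarchy : Graph n → Pred (BinaryTree n) 0ℓ
  IsConnectedHierarchy G T = IsHierarchy T × All (Graph.InducesConnected G) (clusters T)

------------------------------------------------------------------------
-- Ultrametrics on a weighted graph

module _ (ℝ : RealNumbers) where
  open RealNumbers ℝ

  -- Only the values of weight on edges are ever used.
  record Weighting {n : ℕ} (G : Graph n) : Set where
    open Graph G
    field
      weight    : Fin n → Fin n → Carrier
      symmetric : ∀ x y → weight x y ≈ weight y x
      positive  : ∀ {x y} → x ~ y → 0# < weight x y

  record IsUltrametric {n : ℕ} (u : Fin n → Fin n → Carrier) : Set where
    field
      isMetric       : IsGeneralMetric _≡_ _≈_ _≤_ 0# _+_ u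
      strongTriangle : ∀ x y z → u x y ≤ u x z ⊔ u z y

    open IsGeneralMetric isMetric public

module FreeOptimum (ℝ : RealNumbers) {n : ℕ} (G : Graph n)
                   (connected : Graph.Connected G) (w : Weighting ℝ G) where
  open RealNumbers ℝ
  open Graph G
  open GraphMetric G connected
  open Weighting w

  Dominates : Pred (Fin n → Fin n → Carrier) 0ℓ
  Dominates u = ∀ x y → fromℕ (dist x y) ≤ u x y

  cost : (Fin n → Fin n → Carrier) → Carrier
  cost u = ∑ edges (λ (x , y) → weight x y * u x y)

  FreeCost : Pred Carrier 0ℓ
  FreeCost v = ∃ λ u → IsUltrametric ℝ u × Dominates u × v ≈ cost u

  diamLabel : BinaryTree n → Fin n → Fin n → Carrier
  diamLabel T x y = if does (x ≟ y) then 0# else fromℕ (diam (lcaCluster T x y))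

  -- The ultrametric with all distances between distinct vertices equal to D
  -- dominates, so FreeCost is nonempty.
  D : ℕ
  D = suc (diam ⊤)

  discrete : Fin n → Fin n → Carrier
  discrete x y = if does (x ≟ y) then 0# else fromℕ D

  discrete-isUltrametric : IsUltrametric ℝ discrete
  discrete-isUltrametric = record
    { isMetric = record
      { isSemiMetric = record
        { isQuasiSemiMetric = record
          { isPreMetric = record
            { isProtoMetric = record
              { isPartialOrder  = isPartialOrder
              ; ≈-isEquivalence = ≡.isEquivalence
              ; cong            = λ { refl refl → ≈-refl }
              ; nonNegative     = λ {x} {y} → nonNeg x y
              }
            ; ≈⇒0 = λ {x} → λ { refl → diagonal x }
            }
          ; 0⇒≈ = λ {x} {y} → definite x y
          }
        ; sym = swap
        }
      ; triangle = λ x y z → ≤-trans (strong x z y) (⊔≤+ (nonNeg x y) (nonNeg y z))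
      }
    ; strongTriangle = strong
    }
    where
    open NaturalMax totalOrder using (x≤x⊔y; x≤y⊔x; ⊔-lub)

    nonNeg : ∀ x y → 0# ≤ discrete x y
    nonNeg x y with x ≟ y
    ... | yes _ = ≤-refl
    ... | no  _ = fromℕ-nonNegative D

    diagonal : ∀ x → discrete x x ≈ 0#
    diagonal x with x ≟ x
    ... | yes _  = ≈-refl
    ... | no x≢x = contradiction refl x≢x

    definite : ∀ x y → discrete x y ≈ 0# → x ≡ y
    definite x y eq with x ≟ y
    ... | yes x≡y = x≡y
    ... | no  _   = contradiction eq (fromℕ-suc≉0 (diam ⊤))

    swap : ∀ x y → discrete x y ≈ discrete y x
    swap x y with x ≟ y | y ≟ x
    ... | yes _    | yes _    = ≈-refl
    ... | no  _    | no  _    = ≈-refl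
    ... | yes x≡y  | no  y≢x  = contradiction (≡.sym x≡y) y≢x
    ... | no  x≢y  | yes y≡x  = contradiction (≡.sym y≡x) x≢y

    strong : ∀ x y z → discrete x y ≤ discrete x z ⊔ discrete z y
    strong x y z with x ≟ y | x ≟ z | z ≟ y
    ... | yes _   | p       | q       = ≤-trans (lhs p) (x≤x⊔y _ _)
      where
      lhs : (p : Dec (x ≡ z)) → 0# ≤ (if does p then 0# else fromℕ D)
      lhs (yes _) = ≤-refl
      lhs (no _)  = fromℕ-nonNegative D
    ... | no _    | no _    | q       = x≤x⊔y _ _
    ... | no _    | yes _   | no _    = x≤y⊔x _ _
    ... | no x≢y  | yes x≡z | yes z≡y = contradiction (≡.trans x≡z z≡y) x≢y

    ⊔≤+ : ∀ {a b} → 0# ≤ a → 0# ≤ b → a ⊔ b ≤ a + b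
    ⊔≤+ {a} {b} 0≤a 0≤b = ⊔-lub
      (≤-respˡ-≈ (+-identityʳ a) (+-monoʳ-≤ a 0≤b))
      (≤-respˡ-≈ (+-identityˡ b) (+-mono-≤ 0≤a ≤-refl))

  discrete-dominates : Dominates discrete
  discrete-dominates x y with x ≟ y
  ... | no _     = fromℕ-mono-≤ (ℕ.m≤n⇒m≤1+n (dist≤diam ∈⊤ ∈⊤))
  ... | yes refl = fromℕ-mono-≤ (proj₂ (proj₂ (shortest x x)) 0 [])

  FreeCost-nonNegative : LowerBound FreeCost 0#
  FreeCost-nonNegative v (u , isU , _ , v≈) = ≤-respʳ-≈ (≈-sym v≈)
    (∑-nonNegative (All.map
      (λ (_ , x~y) → *-nonNegative (proj₁ (positive x~y)) (IsUltrametric.nonNegative isU))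
      (all-filter (λ (x , y) → (x Fin.<? y) ×-dec (x ~? y))
                  (cartesianProduct (allFin n) (allFin n)))))

  FreeCost-infimum : ∃ (IsInfimum FreeCost)
  FreeCost-infimum = infimum FreeCost
    (cost discrete , discrete , discrete-isUltrametric , discrete-dominates , ≈-refl)
    (0# , FreeCost-nonNegative)

  OPT-free : Carrier
  OPT-free = proj₁ FreeCost-infimum

{-# OPTIONS --safe #-}
module Submission where

-- A diameter labeling costs at least the optimum because it is itself a
-- dominating ultrametric: when the leaves of T are distinct, one of
-- C_T(x,z) and C_T(z,y) contains C_T(x,y), and the diameter is monotone
-- under inclusion (lcaCluster-strong, diamLabel-isUltrametric,
-- diamLabel-dominates).
--
-- Conversely, let u be a dominating ultrametric and run Kruskal's algorithm
-- on the edges sorted by u, recording every union of two components p ∪ q as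
-- a new internal node.  Each cluster formed is connected, since the two
-- merged components are joined by the current edge e.  By the ultrametric
-- inequality all u-distances inside the merged component are at most u e,
-- hence so is its diameter, as u dominates the distance.  Every edge xy
-- running between the two components is still unprocessed, whence
-- u e ≤ u x y.  So the resulting
-- hierarchy satisfies diam C_T(x,y) ≤ u x y on every edge (step-guided,
-- sortedOrder-≤cost) and its diameter labeling costs no more than u.
--
-- The hierarchy produced depends only on the order in which the edges are
-- processed, so finitely many hierarchies suffice for all u.  The cheapest
-- of them (bestTree) costs no more than any dominating ultrametric, and
-- therefore attains the infimum.

import Algebra.Construct.NaturalChoice.Max as NaturalMax
open import Data.Bool.Base using (true; false; _∧_; if_then_else_)
open import Data.Bool.Properties using (∧-comm)
open import Data.Fin.Base using (Fin)
open import Data.Fin.Properties as Fin using (_≟_)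
open import Data.Fin.Subset using (Subset; _∈_; _∉_; _⊆_; _∪_)
open import Data.Fin.Subset.Properties
  using (_∈?_; x∈⁅x⁆; x∈⁅y⁆⇒x≡y; x∈p∪q⁻; x∈p∪q⁺)
open import Data.List.Base
  using (List; []; _∷_; _++_; length; map; filter; allFin; cartesianProduct; cartesianProductWith)
open import Data.List.Extrema.Nat using (argmax-all)
import Data.List.Extrema as Extrema
open import Data.List.Membership.Propositional using () renaming (_∈_ to _∈ˡ_)
open import Data.List.Membership.Propositional.Properties
  using (∈-++⁺ˡ; ∈-++⁺ʳ; ∈-++⁻; ∈-allFin; ∈-filter⁺; ∈-cartesianProduct⁺; ∈-cartesianProductWith⁺)
open import Data.List.Membership.Propositional.Properties.WithK using (unique∧set⇒bag)
open import Data.List.Properties using (++-assoc)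
open import Data.List.Relation.Binary.BagAndSetEquality using (∼bag⇒↭)
open import Data.List.Relation.Binary.Disjoint.Propositional using (Disjoint)
open import Data.List.Relation.Binary.Permutation.Propositional using (↭-sym; ↭⇒↭ₛ)
open import Data.List.Relation.Binary.Permutation.Propositional.Properties
  using (∈-resp-↭; ↭-length; All-resp-↭)
import Data.List.Relation.Binary.Permutation.Setoid.Properties as Permutationₛ
import Data.List.Relation.Binary.Subset.DecPropositional as DecSubset
open import Data.List.Relation.Binary.Subset.Propositional using () renaming (_⊆_ to _⊆ˡ_)
open import Data.List.Relation.Unary.All as All using (All; []; _∷_)
import Data.List.Relation.Unary.All.Properties as All
open import Data.List.Relation.Unary.AllPairs using (AllPairs; []; _∷_)
open import Data.List.Relation.Unary.Any using (here; there)
open import Data.List.Relation.Unary.Sorted.TotalOrder.Properties using (Sorted⇒AllPairs)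
open import Data.List.Relation.Unary.Unique.Propositional using (Unique)
open import Data.List.Relation.Unary.Unique.Propositional.Properties using (++⁺; allFin⁺)
import Data.List.Sort as Sort
open import Data.Nat.Base as ℕ using (ℕ; zero; suc; z≤n)
open import Data.Nat.Properties using (n≤0⇒n≡0)
open import Data.Product.Base using (∃; _×_; _,_; proj₁; proj₂; uncurry)
open import Data.Product.Properties using (≡-dec)
open import Data.Sum.Base as Sum using (_⊎_; inj₁; inj₂)
open import Data.Tree.Binary using (leaf; node; module Leaves)
open import Data.Unit.Base using (tt) renaming (⊤ to Unit)
open import Function.Base using (id; _∘_)
open import Function.Bundles using (mk⇔)
open import Level using (0ℓ)
open import Relation.Binary.Bundles using (DecTotalOrder)
import Relation.Binary.Construct.On as On
open import Relation.Binary.Construct.Closure.ReflexiveTransitive as Star using (Star; ε; _◅_; _◅◅_)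
open import Relation.Binary.Definitions using (tri<; tri≈; tri>)
open import Relation.Binary.PropositionalEquality as ≡ using (_≡_; _≢_; refl; cong; subst)
open import Relation.Nullary using (yes; no; does; contradiction; _×-dec_)
open import Relation.Nullary.Decidable using (dec-true; dec-false)
open import Relation.Unary using (Pred)
open import Defs

------------------------------------------------------------------------
-- Lists

module _ {A : Set} where

  Unique-++⁻ : ∀ xs {ys : List A} → Unique (xs ++ ys) →
               Unique xs × Unique ys × Disjoint xs ys
  Unique-++⁻ []       u        = [] , u , λ ()
  Unique-++⁻ (x ∷ xs) (x∉ ∷ u) =
    let ux , uy , disj = Unique-++⁻ xs u in
    All.++⁻ˡ xs x∉ ∷ ux , uy , λ where
      (here refl , ∈ys) → All.lookup (All.++⁻ʳ xs x∉) ∈ys refl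
      (there ∈xs , ∈ys) → disj (∈xs , ∈ys)

  -- All lists of length k with entries in xs.
  words : List A → ℕ → List (List A)
  words xs zero    = [] ∷ []
  words xs (suc k) = cartesianProductWith _∷_ xs (words xs k)

  words-All : ∀ {P : Pred A 0ℓ} {xs} → All P xs → ∀ k → All (All P) (words xs k)
  words-All pxs zero         = [] ∷ []
  words-All {xs = xs} pxs (suc k) =
    All.cartesianProductWith⁺ (≡.setoid _) (≡.setoid _) _∷_ xs (words xs k)
      (λ x∈ ys∈ → All.lookup pxs x∈ ∷ All.lookup (words-All pxs k) ys∈)

  ∈-words : ∀ {xs ys} → All (_∈ˡ xs) ys → ys ∈ˡ words xs (length ys)
  ∈-words []       = here refl
  ∈-words (p ∷ ps) = ∈-cartesianProductWith⁺ _∷_ p (∈-words ps)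

------------------------------------------------------------------------
-- Leaves and lowest common ancestors

module _ {n : ℕ} where

  leaves : BinaryTree n → List (Fin n)
  leaves = Leaves.toList

  leaves-node : ∀ l {m} r → leaves (node l m r) ≡ leaves l ++ leaves r
  leaves-node l r = toDiffList-++ l (leaves r)
    where
    toDiffList-++ : ∀ (t : BinaryTree n) xs → Leaves.toDiffList t xs ≡ leaves t ++ xs
    toDiffList-++ (leaf x)     xs = refl
    toDiffList-++ (node l _ r) xs = begin
      Leaves.toDiffList l (Leaves.toDiffList r xs) ≡⟨ toDiffList-++ l _ ⟩
      leaves l ++ Leaves.toDiffList r xs           ≡⟨ cong (leaves l ++_) (toDiffList-++ r xs) ⟩
      leaves l ++ leaves r ++ xs                   ≡⟨ ++-assoc (leaves l) _ _ ⟨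
      (leaves l ++ leaves r) ++ xs                 ≡⟨ cong (_++ xs) (toDiffList-++ l _) ⟨
      Leaves.toDiffList l (leaves r) ++ xs         ∎
      where open ≡.≡-Reasoning

  ∈-cluster⇒∈-leaves : ∀ t {x} → x ∈ cluster t → x ∈ˡ leaves t
  ∈-cluster⇒∈-leaves (leaf y)     x∈ = here (x∈⁅y⁆⇒x≡y y x∈)
  ∈-cluster⇒∈-leaves (node l _ r) {x} x∈ = subst (x ∈ˡ_) (≡.sym (leaves-node l r))
    (Sum.[ ∈-++⁺ˡ ∘ ∈-cluster⇒∈-leaves l , ∈-++⁺ʳ (leaves l) ∘ ∈-cluster⇒∈-leaves r ]
      (x∈p∪q⁻ (cluster l) (cluster r) x∈))

  ∈-leaves⇒∈-cluster : ∀ t {x} → x ∈ˡ leaves t → x ∈ cluster t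
  ∈-leaves⇒∈-cluster (leaf y)     (here refl) = x∈⁅x⁆ y
  ∈-leaves⇒∈-cluster (node l _ r) {x} x∈ = x∈p∪q⁺
    (Sum.map (∈-leaves⇒∈-cluster l) (∈-leaves⇒∈-cluster r)
      (∈-++⁻ (leaves l) (subst (x ∈ˡ_) (leaves-node l r) x∈)))

  DistinctLeaves : Pred (BinaryTree n) 0ℓ
  DistinctLeaves t = Unique (leaves t)

  module _ (l : BinaryTree n) {m : Unit} (r : BinaryTree n) where

    private
      split : DistinctLeaves (node l m r) →
              DistinctLeaves l × DistinctLeaves r × Disjoint (leaves l) (leaves r)
      split d = Unique-++⁻ (leaves l) (subst Unique (leaves-node l r) d)

    distinctˡ : DistinctLeaves (node l m r) → DistinctLeaves l
    distinctˡ d = proj₁ (split d)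

    distinctʳ : DistinctLeaves (node l m r) → DistinctLeaves r
    distinctʳ d = proj₁ (proj₂ (split d))

    children-disjoint : DistinctLeaves (node l m r) →
                        ∀ {x} → x ∈ cluster l → x ∉ cluster r
    children-disjoint d x∈l x∈r = proj₂ (proj₂ (split d))
      (∈-cluster⇒∈-leaves l x∈l , ∈-cluster⇒∈-leaves r x∈r)

    distinct-node : DistinctLeaves l → DistinctLeaves r →
                    (∀ {x} → x ∈ cluster l → x ∉ cluster r) → DistinctLeaves (node l m r)
    distinct-node dl dr disj = subst Unique (≡.sym (leaves-node l r))
      (++⁺ dl dr λ (x∈l , x∈r) → disj (∈-leaves⇒∈-cluster l x∈l) (∈-leaves⇒∈-cluster r x∈r))

  lca-comm : ∀ (t : BinaryTree n) x y → lca t x y ≡ lca t y x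
  lca-comm (leaf _)     x y = refl
  lca-comm (node l _ r) x y
    rewrite lca-comm l x y | lca-comm r x y
          | ∧-comm (does (x ∈? cluster l)) (does (y ∈? cluster l))
          | ∧-comm (does (x ∈? cluster r)) (does (y ∈? cluster r)) = refl

  module _ (l : BinaryTree n) {m : Unit} (r : BinaryTree n) {x y : Fin n} where

    lca-left : x ∈ cluster l → y ∈ cluster l → lca (node l m r) x y ≡ lca l x y
    lca-left x∈l y∈l
      rewrite dec-true (x ∈? cluster l) x∈l | dec-true (y ∈? cluster l) y∈l = refl

    lca-right : DistinctLeaves (node l m r) →
                x ∈ cluster r → y ∈ cluster r → lca (node l m r) x y ≡ lca r x y
    lca-right d x∈r y∈r
      rewrite dec-false (x ∈? cluster l) (λ x∈l → children-disjoint l r d x∈l x∈r)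
            | dec-true (x ∈? cluster r) x∈r | dec-true (y ∈? cluster r) y∈r = refl

    lca-across : DistinctLeaves (node l m r) →
                 x ∈ cluster l → y ∈ cluster r → lca (node l m r) x y ≡ node l m r
    lca-across d x∈l y∈r
      rewrite dec-true (x ∈? cluster l) x∈l
            | dec-false (y ∈? cluster l) (λ y∈l → children-disjoint l r d y∈l y∈r)
            | dec-false (x ∈? cluster r) (children-disjoint l r d x∈l) = refl

  lca-across′ : ∀ l {m} r {x y} → DistinctLeaves (node l m r) →
                x ∈ cluster r → y ∈ cluster l → lca (node l m r) x y ≡ node l m r
  lca-across′ l r {x} {y} d x∈r y∈l =
    ≡.trans (lca-comm (node l _ r) x y) (lca-across l r d y∈l x∈r)

  lcaCluster⊆cluster : ∀ (t : BinaryTree n) x y → lcaCluster t x y ⊆ cluster t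
  lcaCluster⊆cluster (leaf _)     x y = id
  lcaCluster⊆cluster (node l _ r) x y
    with does (x ∈? cluster l) ∧ does (y ∈? cluster l)
       | does (x ∈? cluster r) ∧ does (y ∈? cluster r)
  ... | true  | _     = x∈p∪q⁺ ∘ inj₁ ∘ lcaCluster⊆cluster l x y
  ... | false | true  = x∈p∪q⁺ ∘ inj₂ ∘ lcaCluster⊆cluster r x y
  ... | false | false = id

  x∈lcaCluster : ∀ t {x y} → DistinctLeaves t → x ∈ cluster t → y ∈ cluster t →
                 x ∈ lcaCluster t x y
  x∈lcaCluster (leaf _)     d x∈ y∈ = x∈
  x∈lcaCluster (node l _ r) {x} d x∈ y∈
    with x∈p∪q⁻ (cluster l) (cluster r) x∈ | x∈p∪q⁻ (cluster l) (cluster r) y∈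
  ... | inj₁ x∈l | inj₁ y∈l = subst (λ t → x ∈ cluster t) (≡.sym (lca-left l r x∈l y∈l))
                                (x∈lcaCluster l (distinctˡ l r d) x∈l y∈l)
  ... | inj₂ x∈r | inj₂ y∈r = subst (λ t → x ∈ cluster t) (≡.sym (lca-right l r d x∈r y∈r))
                                (x∈lcaCluster r (distinctʳ l r d) x∈r y∈r)
  ... | inj₁ x∈l | inj₂ y∈r = subst (λ t → x ∈ cluster t) (≡.sym (lca-across l r d x∈l y∈r)) x∈
  ... | inj₂ x∈r | inj₁ y∈l = subst (λ t → x ∈ cluster t) (≡.sym (lca-across′ l r d x∈r y∈l)) x∈

  y∈lcaCluster : ∀ t {x y} → DistinctLeaves t → x ∈ cluster t → y ∈ cluster t →
                 y ∈ lcaCluster t x y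
  y∈lcaCluster t {x} {y} d x∈ y∈ =
    subst (λ s → y ∈ cluster s) (lca-comm t y x) (x∈lcaCluster t d y∈ x∈)

  -- The set-theoretic form of the strong triangle inequality.
  lcaCluster-strong : ∀ t {x y z} → DistinctLeaves t →
    x ∈ cluster t → y ∈ cluster t → z ∈ cluster t →
    lcaCluster t x y ⊆ lcaCluster t x z ⊎ lcaCluster t x y ⊆ lcaCluster t z y
  lcaCluster-strong (leaf _) d x∈ y∈ z∈ = inj₁ id
  lcaCluster-strong t@(node l m r) {x} {y} {z} d x∈ y∈ z∈
    with x∈p∪q⁻ (cluster l) (cluster r) x∈ | x∈p∪q⁻ (cluster l) (cluster r) y∈
       | x∈p∪q⁻ (cluster l) (cluster r) z∈
  ... | inj₁ x∈l | inj₁ y∈l | inj₁ z∈l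
      rewrite lca-left l {m} r x∈l y∈l | lca-left l {m} r x∈l z∈l | lca-left l {m} r z∈l y∈l =
        lcaCluster-strong l (distinctˡ l r d) x∈l y∈l z∈l
  ... | inj₂ x∈r | inj₂ y∈r | inj₂ z∈r
      rewrite lca-right l {m} r d x∈r y∈r | lca-right l {m} r d x∈r z∈r
            | lca-right l {m} r d z∈r y∈r =
        lcaCluster-strong r (distinctʳ l r d) x∈r y∈r z∈r
  ... | inj₁ x∈l | _ | inj₂ z∈r rewrite lca-across  l {m} r d x∈l z∈r = inj₁ (lcaCluster⊆cluster t x y)
  ... | inj₂ x∈r | _ | inj₁ z∈l rewrite lca-across′ l {m} r d x∈r z∈l = inj₁ (lcaCluster⊆cluster t x y)
  ... | _ | inj₂ y∈r | inj₁ z∈l rewrite lca-across  l {m} r d z∈l y∈r = inj₂ (lcaCluster⊆cluster t x y)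
  ... | _ | inj₁ y∈l | inj₂ z∈r rewrite lca-across′ l {m} r d z∈r y∈l = inj₂ (lcaCluster⊆cluster t x y)

  module _ (T : BinaryTree n) (hierarchy : IsHierarchy T) where

    hierarchy-distinct : DistinctLeaves T
    hierarchy-distinct = Permutationₛ.Unique-resp-↭ (≡.setoid (Fin n))
      (↭⇒↭ₛ (↭-sym hierarchy)) (allFin⁺ n)

    hierarchy-full : ∀ x → x ∈ cluster T
    hierarchy-full x = ∈-leaves⇒∈-cluster T (∈-resp-↭ (↭-sym hierarchy) (∈-allFin x))

  distinct∧full⇒hierarchy : ∀ (T : BinaryTree n) → DistinctLeaves T →
                            (∀ x → x ∈ cluster T) → IsHierarchy T
  distinct∧full⇒hierarchy T d full = ∼bag⇒↭ (unique∧set⇒bag d (allFin⁺ n)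
    (λ {x} → mk⇔ (λ _ → ∈-allFin x) (λ _ → ∈-cluster⇒∈-leaves T (full x))))

------------------------------------------------------------------------
-- Kruskal's algorithm

module Kruskal {n : ℕ} (G : Graph n) where
  open Graph G

  edges-sound : All (uncurry _~_) edges
  edges-sound = All.map proj₂ (All.all-filter (λ (x , y) → (x Fin.<? y) ×-dec (x ~? y))
    (cartesianProduct (allFin n) (allFin n)))

  edges-complete : ∀ {x y} → x ~ y → (x , y) ∈ˡ edges ⊎ (y , x) ∈ˡ edges
  edges-complete {x} {y} x~y with Fin.<-cmp x y
  ... | tri< x<y _ _ = inj₁ (∈-filter⁺ (λ (x , y) → (x Fin.<? y) ×-dec (x ~? y))
                         (∈-cartesianProduct⁺ (∈-allFin x) (∈-allFin y)) (x<y , x~y))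
  ... | tri≈ _ x≡y _ = contradiction x~y (~-irrefl x≡y)
  ... | tri> _ _ y<x = inj₂ (∈-filter⁺ (λ (x , y) → (x Fin.<? y) ×-dec (x ~? y))
                         (∈-cartesianProduct⁺ (∈-allFin y) (∈-allFin x)) (y<x , ~-sym x~y))

  -- A state assigns to every vertex the hierarchy of its component.
  State : Set
  State = Fin n → BinaryTree n

  -- The components of p and q become the children of a new root.
  merge : State → Fin n → Fin n → State
  merge s p q v =
    if does (v ∈? cluster (s p) ∪ cluster (s q)) then node (s p) tt (s q) else s v

  -- An edge inside a component changes nothing.
  step : State → Fin n × Fin n → State
  step s (p , q) = if does (q ∈? cluster (s p)) then s else merge s p q

  -- The components joined by successive edges, in the order of the list.
  kruskal : State → List (Fin n × Fin n) → State
  kruskal s []       = s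
  kruskal s (e ∷ es) = kruskal (step s e) es

  merge-elim : ∀ {s p q} v (P : Pred (BinaryTree n) 0ℓ) →
               (v ∈ cluster (s p) ∪ cluster (s q) → P (node (s p) tt (s q))) →
               (v ∉ cluster (s p) ∪ cluster (s q) → P (s v)) → P (merge s p q v)
  merge-elim {s} {p} {q} v P inside outside with v ∈? cluster (s p) ∪ cluster (s q)
  ... | yes v∈ = inside v∈
  ... | no  v∉ = outside v∉

  step-elim : ∀ {s p q} (P : Pred State 0ℓ) →
              (q ∈ cluster (s p) → P s) → (q ∉ cluster (s p) → P (merge s p q)) →
              P (step s (p , q))
  step-elim {s} {p} {q} P skip join with q ∈? cluster (s p)
  ... | yes q∈ = skip q∈
  ... | no  q∉ = join q∉

  -- The components partition the vertices, and the tree of each of them is a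
  -- connected hierarchy on it.
  record IsForest (s : State) : Set where
    field
      own       : ∀ v → v ∈ cluster (s v)
      same      : ∀ {v x} → x ∈ cluster (s v) → s x ≡ s v
      connected : ∀ v → All InducesConnected (clusters (s v))
      distinct  : ∀ v → DistinctLeaves (s v)

  IsForest-leaf : IsForest leaf
  IsForest-leaf = record
    { own       = x∈⁅x⁆
    ; same      = λ {v} x∈ → cong leaf (x∈⁅y⁆⇒x≡y v x∈)
    ; connected = λ v → (λ x y x∈ y∈ → subst (Star _ x)
        (≡.trans (x∈⁅y⁆⇒x≡y v x∈) (≡.sym (x∈⁅y⁆⇒x≡y v y∈))) ε) ∷ []
    ; distinct  = λ v → [] ∷ []
    }

  cluster-connected : ∀ t → All InducesConnected (clusters t) → InducesConnected (cluster t)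
  cluster-connected (leaf _)     (c ∷ _) = c
  cluster-connected (node _ _ _) (c ∷ _) = c

  ∪-connected : ∀ {S S′ p q} → p ∈ S → q ∈ S′ → p ~ q →
                InducesConnected S → InducesConnected S′ → InducesConnected (S ∪ S′)
  ∪-connected {S} {S′} {p} {q} p∈ q∈ p~q c c′ x y x∈ y∈ =
    to-p x∈ ◅◅ Star.reverse (λ (a∈ , b∈ , e) → b∈ , a∈ , ~-sym e) (to-p y∈)
    where
    to-p : ∀ {v} → v ∈ S ∪ S′ → Star (λ a b → a ∈ S ∪ S′ × b ∈ S ∪ S′ × a ~ b) v p
    to-p {v} v∈ with x∈p∪q⁻ S S′ v∈
    ... | inj₁ v∈S  = Star.map (λ (a∈ , b∈ , e) → x∈p∪q⁺ (inj₁ a∈) , x∈p∪q⁺ (inj₁ b∈) , e)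
                        (c v p v∈S p∈)
    ... | inj₂ v∈S′ = Star.map (λ (a∈ , b∈ , e) → x∈p∪q⁺ (inj₂ a∈) , x∈p∪q⁺ (inj₂ b∈) , e)
                        (c′ v q v∈S′ q∈)
                      ◅◅ (x∈p∪q⁺ (inj₂ q∈) , x∈p∪q⁺ (inj₁ p∈) , ~-sym p~q) ◅ ε

  module _ {s : State} (forest : IsForest s) where
    open IsForest forest

    components-disjoint : ∀ {p q} → q ∉ cluster (s p) →
                          ∀ {x} → x ∈ cluster (s p) → x ∉ cluster (s q)
    components-disjoint {p} {q} q∉ x∈p x∈q =
      q∉ (subst (λ t → q ∈ cluster t) (≡.trans (≡.sym (same x∈q)) (same x∈p)) (own q))

    merged-distinct : ∀ {p q} → q ∉ cluster (s p) → DistinctLeaves (node (s p) tt (s q))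
    merged-distinct {p} {q} q∉ =
      distinct-node (s p) (s q) (distinct p) (distinct q) (components-disjoint q∉)

    cluster⊆union : ∀ {p q v} → v ∈ cluster (s p) ∪ cluster (s q) →
                    cluster (s v) ⊆ cluster (s p) ∪ cluster (s q)
    cluster⊆union {p} {q} v∈ {x} x∈ with x∈p∪q⁻ (cluster (s p)) (cluster (s q)) v∈
    ... | inj₁ v∈p = x∈p∪q⁺ (inj₁ (subst (λ t → x ∈ cluster t) (same v∈p) x∈))
    ... | inj₂ v∈q = x∈p∪q⁺ (inj₂ (subst (λ t → x ∈ cluster t) (same v∈q) x∈))

    merge-grows : ∀ {p q} v → cluster (s v) ⊆ cluster (merge s p q v)
    merge-grows {p} {q} v {x} x∈ = merge-elim {s} v (λ t → x ∈ cluster t)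
      (λ v∈ → cluster⊆union v∈ x∈) (λ _ → x∈)

    step-grows : ∀ {e} v → cluster (s v) ⊆ cluster (step s e v)
    step-grows {p , q} v {x} x∈ = step-elim {s} {p} {q} (λ s′ → x ∈ cluster (s′ v))
      (λ _ → x∈) (λ _ → merge-grows v x∈)

    step-joins : ∀ p q → q ∈ cluster (step s (p , q) p)
    step-joins p q = step-elim {s} {p} {q} (λ s′ → q ∈ cluster (s′ p)) id
      (λ _ → merge-elim {s} p (λ t → q ∈ cluster t)
        (λ _ → x∈p∪q⁺ (inj₂ (own q)))
        (λ p∉ → contradiction (x∈p∪q⁺ (inj₁ (own p))) p∉))

    merge-forest : ∀ {p q} → p ~ q → q ∉ cluster (s p) → IsForest (merge s p q)
    merge-forest {p} {q} p~q q∉ = record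
      { own       = λ v → merge-elim {s} v (λ t → v ∈ cluster t) id (λ _ → own v)
      ; same      = λ {v} {x} → merge-elim {s} v (λ t → x ∈ cluster t → merge s p q x ≡ t)
          (λ _ x∈ → merge-elim {s} x (_≡ node (s p) tt (s q)) (λ _ → refl) (contradiction x∈))
          (λ v∉ x∈ → merge-elim {s} x (_≡ s v)
            (λ x∈∪ → contradiction
              (cluster⊆union x∈∪ (subst (λ t → v ∈ cluster t) (≡.sym (same x∈)) (own v))) v∉)
            (λ _ → same x∈))
      ; connected = λ v → merge-elim {s} v (All InducesConnected ∘ clusters)
          (λ _ → ∪-connected (own p) (own q) p~q
                   (cluster-connected (s p) (connected p)) (cluster-connected (s q) (connected q))
                 ∷ All.++⁺ (connected p) (connected q))
          (λ _ → connected v)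
      ; distinct  = λ v → merge-elim {s} v DistinctLeaves
          (λ _ → merged-distinct q∉) (λ _ → distinct v)
      }

    step-forest : ∀ {p q} → p ~ q → IsForest (step s (p , q))
    step-forest {p} {q} p~q =
      step-elim {s} {p} {q} IsForest (λ _ → forest) (merge-forest p~q)

  kruskal-forest : ∀ {s es} → All (uncurry _~_) es → IsForest s → IsForest (kruskal s es)
  kruskal-forest []         forest = forest
  kruskal-forest (e~ ∷ es~) forest = kruskal-forest es~ (step-forest forest e~)

  kruskal-grows : ∀ {s es} → All (uncurry _~_) es → IsForest s →
                  ∀ v → cluster (s v) ⊆ cluster (kruskal s es v)
  kruskal-grows []         forest v x∈ = x∈
  kruskal-grows {es = e ∷ _} (e~ ∷ es~) forest v x∈ =
    kruskal-grows es~ (step-forest forest e~) v (step-grows forest {e} v x∈)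

  kruskal-joins : ∀ {s es} → All (uncurry _~_) es → IsForest s →
                  ∀ {p q} → (p , q) ∈ˡ es → q ∈ cluster (kruskal s es p)
  kruskal-joins (e~ ∷ es~) forest {p} {q} (here refl) =
    kruskal-grows es~ (step-forest forest e~) p (step-joins forest p q)
  kruskal-joins (e~ ∷ es~) forest (there e∈) =
    kruskal-joins es~ (step-forest forest e~) e∈

  -- The lists that consist of edges and contain all of them; repetitions are
  -- harmless, as a repeated edge is skipped.
  IsEdgeOrder : Pred (List (Fin n × Fin n)) 0ℓ
  IsEdgeOrder es = All (uncurry _~_) es × edges ⊆ˡ es

  kruskal-hierarchy : Connected → ∀ {es} → IsEdgeOrder es →
                      ∀ v → IsConnectedHierarchy G (kruskal leaf es v)
  kruskal-hierarchy conn {es} (es~ , edges⊆es) v =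
    distinct∧full⇒hierarchy (kruskal leaf es v) (distinct v)
      (λ x → subst (λ t → x ∈ cluster t) (all-same (conn x v)) (own x)) ,
    connected v
    where
    forest : IsForest (kruskal leaf es)
    forest = kruskal-forest es~ IsForest-leaf
    open IsForest forest

    adjacent : ∀ {x y} → x ~ y → kruskal leaf es x ≡ kruskal leaf es y
    adjacent x~y with edges-complete x~y
    ... | inj₁ e∈ = ≡.sym (same (kruskal-joins es~ IsForest-leaf (edges⊆es e∈)))
    ... | inj₂ e∈ = same (kruskal-joins es~ IsForest-leaf (edges⊆es e∈))

    all-same : ∀ {x y} → Star _~_ x y → kruskal leaf es x ≡ kruskal leaf es y
    all-same = Star.fold (λ x y → kruskal leaf es x ≡ kruskal leaf es y)
      (λ x~y eq → ≡.trans (adjacent x~y) eq) refl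

------------------------------------------------------------------------
-- Distances and diameters

module _ {n : ℕ} (G : Graph n) (connected : Graph.Connected G) where
  open Graph G
  open GraphMetric G connected

  -- The case 0 covers the empty set.
  diam-elim : ∀ {S} (P : Pred ℕ 0ℓ) → P 0 → (∀ {a b} → a ∈ S → b ∈ S → P (dist a b)) →
              P (diam S)
  diam-elim {S} P P0 Pdist = argmax-all id {P = P} P0 (All.map⁺ (All.map
    (λ (a∈ , b∈) → Pdist a∈ b∈)
    (All.all-filter (λ (a , b) → (a ∈? S) ×-dec (b ∈? S)) (cartesianProduct (allFin n) (allFin n)))))

  diam-mono-⊆ : ∀ {S S′} → S ⊆ S′ → diam S ℕ.≤ diam S′
  diam-mono-⊆ {S′ = S′} S⊆S′ =
    diam-elim (ℕ._≤ diam S′) z≤n (λ a∈ b∈ → dist≤diam (S⊆S′ a∈) (S⊆S′ b∈))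

  dist≡0⇒≡ : ∀ {x y} → dist x y ≡ 0 → x ≡ y
  dist≡0⇒≡ {x} {y} eq with shortest x y
  dist≡0⇒≡ refl | .0 , [] , _ = refl

------------------------------------------------------------------------
-- Sums and products of real numbers

module _ (ℝ : RealNumbers) where
  open RealNumbers ℝ
  open NaturalMax totalOrder using (⊔-lub)

  *-monoˡ-≤-nonNeg : ∀ {c x y} → 0# ≤ c → x ≤ y → c * x ≤ c * y
  *-monoˡ-≤-nonNeg {c} {x} {y} 0≤c x≤y =
    ≤-respˡ-≈ (+-identityʳ (c * x)) (≤-respʳ-≈ eq (+-monoʳ-≤ (c * x) (*-nonNegative 0≤c 0≤y-x)))
    where
    0≤y-x : 0# ≤ - x + y
    0≤y-x = ≤-respˡ-≈ (-‿inverseˡ x) (+-monoʳ-≤ (- x) x≤y)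

    eq : c * x + c * (- x + y) ≈ c * y
    eq = ≈-trans (≈-sym (distribˡ c x (- x + y))) (*-cong ≈-refl
      (≈-trans (≈-sym (+-assoc x (- x) y))
        (≈-trans (+-cong (-‿inverseʳ x) ≈-refl) (+-identityˡ y))))

  ∑-mono-≤ : ∀ {A : Set} {xs : List A} {f g} → All (λ x → f x ≤ g x) xs → ∑ xs f ≤ ∑ xs g
  ∑-mono-≤ []       = ≤-refl
  ∑-mono-≤ (p ∷ ps) = +-mono-≤ p (∑-mono-≤ ps)

  ⊔≤+ : ∀ {a b} → 0# ≤ a → 0# ≤ b → a ⊔ b ≤ a + b
  ⊔≤+ {a} {b} 0≤a 0≤b = ⊔-lub
    (≤-respˡ-≈ (+-identityʳ a) (+-monoʳ-≤ a 0≤b))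
    (≤-respˡ-≈ (+-identityˡ b) (+-mono-≤ 0≤a ≤-refl))

module _ (ℝ : RealNumbers) {n : ℕ} (G : Graph n)
         (connected : Graph.Connected G) (w : Weighting ℝ G) where
  open RealNumbers ℝ
  open Graph G hiding (Connected)
  open GraphMetric G connected
  open Weighting w using (weight; positive)
  open FreeOptimum ℝ G connected w
  open Kruskal G
  open NaturalMax totalOrder using (x≤x⊔y; x≤y⊔x; ⊔-lub)

  -- The quantity that is minimised over hierarchies, i.e. the cost of diamLabel T.
  treeCost : BinaryTree n → Carrier
  treeCost T = ∑ edges (λ (x , y) → weight x y * fromℕ (diam (lcaCluster T x y)))

  cost-mono-≤ : ∀ {u u′ : Fin n → Fin n → Carrier} →
               All (λ (x , y) → u x y ≤ u′ x y) edges → cost u ≤ cost u′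
  cost-mono-≤ le = ∑-mono-≤ ℝ (All.zipWith
    (λ (x~y , p) → *-monoˡ-≤-nonNeg ℝ (proj₁ (positive x~y)) p) (edges-sound , le))

------------------------------------------------------------------------
-- Diameter labelings are dominating ultrametrics

  diamLabel-≢ : ∀ T {x y} → x ≢ y → diamLabel T x y ≡ fromℕ (diam (lcaCluster T x y))
  diamLabel-≢ T {x} {y} x≢y rewrite dec-false (x ≟ y) x≢y = refl

  cost-diamLabel : ∀ T → cost (diamLabel T) ≈ treeCost T
  cost-diamLabel T = antisym
    (cost-mono-≤ (All.map (λ x~y → ≤-reflexive (reflexive (label x~y))) edges-sound))
    (cost-mono-≤ (All.map (λ x~y → ≤-reflexive (reflexive (≡.sym (label x~y)))) edges-sound))
    where
    label : ∀ {x y} → x ~ y → diamLabel T x y ≡ fromℕ (diam (lcaCluster T x y))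
    label x~y = diamLabel-≢ T (λ x≡y → ~-irrefl x≡y x~y)

  module _ (T : BinaryTree n) (hierarchy : IsHierarchy T) where

    private
      d    = hierarchy-distinct T hierarchy
      full = hierarchy-full T hierarchy

    dist≤lcaDiam : ∀ x y → dist x y ℕ.≤ diam (lcaCluster T x y)
    dist≤lcaDiam x y =
      dist≤diam (x∈lcaCluster T d (full x) (full y)) (y∈lcaCluster T d (full x) (full y))

    diamLabel-dominates : Dominates (diamLabel T)
    diamLabel-dominates x y with x ≟ y
    ... | yes refl = fromℕ-mono-≤ (proj₂ (proj₂ (shortest x x)) 0 [])
    ... | no  _    = fromℕ-mono-≤ (dist≤lcaDiam x y)

    diamLabel-isUltrametric : IsUltrametric ℝ (diamLabel T)
    diamLabel-isUltrametric = record
      { isMetric = record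
        { isSemiMetric = record
          { isQuasiSemiMetric = record
            { isPreMetric = record
              { isProtoMetric = record
                { isPartialOrder  = isPartialOrder
                ; ≈-isEquivalence = ≡.isEquivalence
                ; cong            = λ { refl refl → ≈-refl }
                ; nonNegative     = λ {x} {y} → nonNeg x y
                }
              ; ≈⇒0 = λ {x} → λ { refl → diagonal x }
              }
            ; 0⇒≈ = λ {x} {y} → definite x y
            }
          ; sym = swap
          }
        ; triangle = λ x y z → ≤-trans (strong x z y) (⊔≤+ ℝ (nonNeg x y) (nonNeg y z))
        }
      ; strongTriangle = strong
      }
      where
      nonNeg : ∀ x y → 0# ≤ diamLabel T x y
      nonNeg x y with x ≟ y
      ... | yes _ = ≤-refl
      ... | no  _ = fromℕ-nonNegative (diam (lcaCluster T x y))

      diagonal : ∀ x → diamLabel T x x ≈ 0#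
      diagonal x rewrite dec-true (x ≟ x) refl = ≈-refl

      fromℕ≈0⇒≡0 : ∀ k → fromℕ k ≈ 0# → k ≡ 0
      fromℕ≈0⇒≡0 zero    _  = refl
      fromℕ≈0⇒≡0 (suc k) eq = contradiction eq (fromℕ-suc≉0 k)

      definite : ∀ x y → diamLabel T x y ≈ 0# → x ≡ y
      definite x y eq with x ≟ y
      ... | yes x≡y = x≡y
      ... | no  _   = dist≡0⇒≡ G connected (n≤0⇒n≡0
        (subst (dist x y ℕ.≤_) (fromℕ≈0⇒≡0 _ eq) (dist≤lcaDiam x y)))

      swap : ∀ x y → diamLabel T x y ≈ diamLabel T y x
      swap x y with x ≟ y | y ≟ x
      ... | yes _   | yes _   = ≈-refl
      ... | no  _   | no  _   = reflexive (cong (fromℕ ∘ diam ∘ cluster) (lca-comm T x y))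
      ... | yes x≡y | no  y≢x = contradiction (≡.sym x≡y) y≢x
      ... | no  x≢y | yes y≡x = contradiction (≡.sym y≡x) x≢y

      strong : ∀ x y z → diamLabel T x y ≤ diamLabel T x z ⊔ diamLabel T z y
      strong x y z with x ≟ y
      ... | yes _   = ≤-trans (nonNeg x z) (x≤x⊔y _ _)
      ... | no  x≢y with x ≟ z | z ≟ y
      ...   | yes refl | yes z≡y  = contradiction z≡y x≢y
      ...   | yes refl | no  _    = x≤y⊔x _ _
      ...   | no  _    | yes refl = x≤x⊔y _ _
      ...   | no  _    | no  _    with lcaCluster-strong T d (full x) (full y) (full z)
      ...     | inj₁ ⊆xz = ≤-trans (fromℕ-mono-≤ (diam-mono-⊆ G connected ⊆xz)) (x≤x⊔y _ _)
      ...     | inj₂ ⊆zy = ≤-trans (fromℕ-mono-≤ (diam-mono-⊆ G connected ⊆zy)) (x≤y⊔x _ _)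

    OPT≤treeCost : OPT-free ≤ treeCost T
    OPT≤treeCost = proj₁ (proj₂ FreeCost-infimum) (treeCost T)
      (diamLabel T , diamLabel-isUltrametric , diamLabel-dominates , ≈-sym (cost-diamLabel T))

------------------------------------------------------------------------
-- Kruskal's algorithm guided by a dominating ultrametric

  module _ {u : Fin n → Fin n → Carrier}
           (isU : IsUltrametric ℝ u) (dominates : Dominates u) where
    open IsUltrametric isU using (strongTriangle; nonNegative; ≈⇒0) renaming (sym to u-sym)

    -- The invariant when the edges es remain to be processed in increasing
    -- order of u.
    --  * bound: a component has u-diameter at most u of every remaining edge;
    --  * label: diameter labels are at most u on the edges inside a component;
    --  * pending: an edge between different components has yet to be processed.
    record Guided (s : State) (es : List (Fin n × Fin n)) : Set where
      field
        bound   : ∀ v {a b} → a ∈ cluster (s v) → b ∈ cluster (s v) →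
                  All (λ e → u a b ≤ uncurry u e) es
        label   : ∀ v {x y} → (x , y) ∈ˡ edges → x ∈ cluster (s v) → y ∈ cluster (s v) →
                  fromℕ (diam (lcaCluster (s v) x y)) ≤ u x y
        pending : ∀ {x y} → (x , y) ∈ˡ edges → (x , y) ∈ˡ es ⊎ y ∈ cluster (s x)

    guided-leaf : ∀ {es} → edges ⊆ˡ es → Guided leaf es
    guided-leaf edges⊆es = record
      { bound   = λ v a∈ b∈ → All.universal (λ _ → ≤-respˡ-≈
          (≈-sym (≈⇒0 (≡.trans (x∈⁅y⁆⇒x≡y v a∈) (≡.sym (x∈⁅y⁆⇒x≡y v b∈))))) nonNegative) _
      ; label   = λ v e∈ x∈ y∈ → contradiction (All.lookup edges-sound e∈)
          (~-irrefl (≡.trans (x∈⁅y⁆⇒x≡y v x∈) (≡.sym (x∈⁅y⁆⇒x≡y v y∈))))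
      ; pending = inj₁ ∘ edges⊆es
      }

    step-guided : ∀ {s p q es} → IsForest s → All (λ e → u p q ≤ uncurry u e) es →
                  Guided s ((p , q) ∷ es) → Guided (step s (p , q)) es
    step-guided {s} {p} {q} {es} forest least guided =
      step-elim {s} {p} {q} (λ s′ → Guided s′ es) skip join
      where
      open Guided guided
      open IsForest forest using (own; same)

      skip : q ∈ cluster (s p) → Guided s es
      skip q∈ = record
        { bound   = λ v a∈ b∈ → All.tail (bound v a∈ b∈)
        ; label   = label
        ; pending = λ e∈ → skip-pending (pending e∈)
        }
        where
        skip-pending : ∀ {x y} → (x , y) ∈ˡ (p , q) ∷ es ⊎ y ∈ cluster (s x) →
                       (x , y) ∈ˡ es ⊎ y ∈ cluster (s x)
        skip-pending (inj₁ (here refl)) = inj₂ q∈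
        skip-pending (inj₁ (there e∈))  = inj₁ e∈
        skip-pending (inj₂ y∈)          = inj₂ y∈

      join : q ∉ cluster (s p) → Guided (merge s p q) es
      join q∉ = record
        { bound   = λ v {a} {b} → merge-elim {s} v
            (λ t → a ∈ cluster t → b ∈ cluster t → All (λ e → u a b ≤ uncurry u e) es)
            (λ _ a∈ b∈ → All.map (≤-trans (within a∈ b∈)) least)
            (λ _ a∈ b∈ → All.tail (bound v a∈ b∈))
        ; label   = λ v {x} {y} e∈ → merge-elim {s} v
            (λ t → x ∈ cluster t → y ∈ cluster t → fromℕ (diam (lcaCluster t x y)) ≤ u x y)
            (λ _ x∈ y∈ → label-merged e∈ (x∈p∪q⁻ L R x∈) (x∈p∪q⁻ L R y∈))
            (λ _ → label v e∈)
        ; pending = λ e∈ → join-pending (pending e∈)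
        }
        where
        L R : Subset n
        L = cluster (s p)
        R = cluster (s q)

        to-p : ∀ {a} → a ∈ L ∪ R → u a p ≤ u p q
        to-p a∈ with x∈p∪q⁻ L R a∈
        ... | inj₁ a∈L = All.head (bound p a∈L (own p))
        ... | inj₂ a∈R = ≤-trans (strongTriangle _ p q)
                           (⊔-lub (All.head (bound q a∈R (own q))) (≤-reflexive (u-sym q p)))

        within : ∀ {a b} → a ∈ L ∪ R → b ∈ L ∪ R → u a b ≤ u p q
        within {a} {b} a∈ b∈ = ≤-trans (strongTriangle a b p)
          (⊔-lub (to-p a∈) (≤-respˡ-≈ (u-sym b p) (to-p b∈)))

        diam≤ : fromℕ (diam (L ∪ R)) ≤ u p q
        diam≤ = diam-elim G connected (λ k → fromℕ k ≤ u p q) nonNegative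
          (λ a∈ b∈ → ≤-trans (dominates _ _) (within a∈ b∈))

        separate : ∀ {x y} → (x , y) ∈ˡ edges → y ∉ cluster (s x) → u p q ≤ u x y
        separate e∈ y∉ with pending e∈
        ... | inj₁ (here refl)  = ≤-refl
        ... | inj₁ (there e∈es) = All.lookup least e∈es
        ... | inj₂ y∈           = contradiction y∈ y∉

        d = merged-distinct forest q∉
        disj = components-disjoint forest q∉

        label-merged : ∀ {x y} → (x , y) ∈ˡ edges → x ∈ L ⊎ x ∈ R → y ∈ L ⊎ y ∈ R →
                       fromℕ (diam (lcaCluster (node (s p) tt (s q)) x y)) ≤ u x y
        label-merged e∈ (inj₁ x∈L) (inj₁ y∈L)
          rewrite lca-left (s p) {tt} (s q) x∈L y∈L = label p e∈ x∈L y∈L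
        label-merged e∈ (inj₂ x∈R) (inj₂ y∈R)
          rewrite lca-right (s p) (s q) d x∈R y∈R = label q e∈ x∈R y∈R
        label-merged {x} {y} e∈ (inj₁ x∈L) (inj₂ y∈R)
          rewrite lca-across (s p) (s q) d x∈L y∈R =
          ≤-trans diam≤ (separate e∈ λ y∈ → disj (subst (λ t → y ∈ cluster t) (same x∈L) y∈) y∈R)
        label-merged {x} {y} e∈ (inj₂ x∈R) (inj₁ y∈L)
          rewrite lca-across′ (s p) (s q) d x∈R y∈L =
          ≤-trans diam≤ (separate e∈ λ y∈ → disj y∈L (subst (λ t → y ∈ cluster t) (same x∈R) y∈))

        join-pending : ∀ {x y} → (x , y) ∈ˡ (p , q) ∷ es ⊎ y ∈ cluster (s x) →
                       (x , y) ∈ˡ es ⊎ y ∈ cluster (merge s p q x)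
        join-pending (inj₁ (here refl)) = inj₂ (merge-elim {s} p (λ t → q ∈ cluster t)
          (λ _ → x∈p∪q⁺ (inj₂ (own q)))
          (λ p∉ → contradiction (x∈p∪q⁺ (inj₁ (own p))) p∉))
        join-pending (inj₁ (there e∈))  = inj₁ e∈
        join-pending {x} (inj₂ y∈)      = inj₂ (merge-grows forest x y∈)

    kruskal-guided : ∀ {s es} → All (uncurry _~_) es →
                     AllPairs (λ e f → uncurry u e ≤ uncurry u f) es →
                     IsForest s → Guided s es → Guided (kruskal s es) []
    kruskal-guided []         []               forest guided = guided
    kruskal-guided (e~ ∷ es~) (least ∷ sorted) forest guided =
      kruskal-guided es~ sorted (step-forest forest e~) (step-guided forest least guided)

    -- Once all edges have been processed, the label bound covers every edge.
    sortedOrder-≤cost : ∀ {es} → IsEdgeOrder es → AllPairs (λ e f → uncurry u e ≤ uncurry u f) es →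
                   ∀ v → treeCost (kruskal leaf es v) ≤ cost u
    sortedOrder-≤cost {es} order@(es~ , edges⊆es) sorted v = cost-mono-≤ (All.tabulate λ e∈ →
      Guided.label (kruskal-guided es~ sorted IsForest-leaf (guided-leaf edges⊆es))
        v e∈ (full _) (full _))
      where
      full = hierarchy-full (kruskal leaf es v) (proj₁ (kruskal-hierarchy connected order v))

    -- Sorting permutes the edges, so the result is among the words of that length.
    sortedEdges : ∃ λ es → IsEdgeOrder es × es ∈ˡ words edges (length edges) ×
                           AllPairs (λ e f → uncurry u e ≤ uncurry u f) es
    sortedEdges = sort edges ,
      (All-resp-↭ (↭-sym perm) edges-sound , ∈-resp-↭ (↭-sym perm)) ,
      subst (λ k → sort edges ∈ˡ words edges k) (↭-length perm)
        (∈-words (All-resp-↭ (↭-sym perm) (All.tabulate id))) ,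
      Sorted⇒AllPairs (DecTotalOrder.totalOrder byU) (sort-↗ edges)
      where
      byU : DecTotalOrder 0ℓ 0ℓ 0ℓ
      byU = On.decTotalOrder (record { isDecTotalOrder = isDecTotalOrder }) (uncurry u)
      open Sort byU
      perm = sort-↭ edges

------------------------------------------------------------------------
-- The cheapest processing order

  -- The vertex v only serves to name the final component, which is everything.
  module _ (v : Fin n) where
    open DecSubset (≡-dec (_≟_ {n}) (_≟_ {n})) using (_⊆?_)
    open Extrema totalOrder using (argmin; argmin-all; f[argmin]≤f[xs])

    -- Finitely many processing orders, among them the edges sorted by any u.
    edgeOrders : List (List (Fin n × Fin n))
    edgeOrders = filter (edges ⊆?_) (words edges (length edges))

    orderCost : List (Fin n × Fin n) → Carrier
    orderCost es = treeCost (kruskal leaf es v)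

    -- The first argument of argmin is a default value, itself a processing order.
    bestOrder : List (Fin n × Fin n)
    bestOrder = argmin orderCost edges edgeOrders

    bestTree : BinaryTree n
    bestTree = kruskal leaf bestOrder v

    bestTree-hierarchy : IsConnectedHierarchy G bestTree
    bestTree-hierarchy = kruskal-hierarchy connected
      (argmin-all orderCost {P = IsEdgeOrder} (edges-sound , id)
        (All.zip (All.filter⁺ (edges ⊆?_) (words-All edges-sound (length edges)) ,
                  All.all-filter (edges ⊆?_) (words edges (length edges)))))
      v

    bestTree-lowerBound : LowerBound FreeCost (treeCost bestTree)
    bestTree-lowerBound c (u , isU , dominates , c≈) =
      let es , order@(_ , edges⊆es) , es∈ , sorted = sortedEdges isU dominates in
      ≤-respʳ-≈ (≈-sym c≈) (≤-trans
        (All.lookup (f[argmin]≤f[xs] {f = orderCost} edges edgeOrders)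
          (∈-filter⁺ (edges ⊆?_) es∈ edges⊆es))
        (sortedOrder-≤cost isU dominates order sorted v))

    treeCost-best : treeCost bestTree ≈ OPT-free
    treeCost-best = antisym
      (proj₂ (proj₂ FreeCost-infimum) (treeCost bestTree) bestTree-lowerBound)
      (OPT≤treeCost bestTree (proj₁ bestTree-hierarchy))

corollary2 : (ℝ : RealNumbers) (n : ℕ) → 2 ℕ.≤ n →
    (G : Graph n) (connected : Graph.Connected G) (w : Weighting ℝ G) →
    let open RealNumbers ℝ
        open Graph G using (edges)
        open GraphMetric G connected using (diam)
        open Weighting w using (weight)
        open FreeOptimum ℝ G connected w
    in
    IsMinimumOf (IsConnectedHierarchy G)
      (λ T → ∑ edges (λ (x , y) → weight x y * fromℕ (diam (lcaCluster T x y))))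
      OPT-free
    ×
    ∃ (λ T → IsConnectedHierarchy G T ×
      IsUltrametric ℝ (diamLabel T) × Dominates (diamLabel T) ×
      cost (diamLabel T) ≈ OPT-free)
corollary2 ℝ (suc n) _ G connected w =
  ((T , conn , treeCost-best ℝ G connected w root) ,
   λ T′ conn′ → OPT≤treeCost ℝ G connected w T′ (proj₁ conn′)) ,
  (T , conn ,
   diamLabel-isUltrametric ℝ G connected w T (proj₁ conn) ,
   diamLabel-dominates ℝ G connected w T (proj₁ conn) ,
   RealNumbers.≈-trans ℝ (cost-diamLabel ℝ G connected w T) (treeCost-best ℝ G connected w root))
  where
  root : Fin (suc n)
  root = Fin.zero
  T = bestTree ℝ G connected w root
  conn = bestTree-hierarchy ℝ G connected w root
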